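{- Let $G$ and $H$ be vertex-disjoint connected graphs, let $u_1,\dots,u_k$ be pairwise distinct vertices of $G$ and $v_1,\dots,v_k$ pairwise distinct vertices of $H$. If $G(\mathbf P)$ and $H(\mathbf P)$ are $T$-equivalent for every partition $\mathbf P$ of $\{1,\dots,k\}$, then for an arbitrary graph $W$ (vertex-disjoint from $G$ and $H$) with pairwise distinct vertices $w_1,\dots,w_k$, the graphs $G(u_1,\dots,u_k)\sqcup W(w_1,\dots,w_k)$ and $H(v_1,\dots,v_k)\sqcup W(w_1,\dots,w_k)$ are $T$-equivalent.
   Context: Graphs may have loops and parallel edges. The Tutte polynomial of $G=(V,E)$ is $T_G(x,y)=\sum_{A\subseteq E}(x-1)^{r(E)-r(A)}(y-1)^{|A|-r(A)}$ with $r(A)=|V|-c(A)$, $c(A)$ the number of components of $(V,A)$; two graphs are $T$-equivalent if they have the same Tutte polynomial. For a partition $\mathbf P=\{P_1,\dots,P_r\}$ of $\{1,\dots,k\}$, $G(\mathbf P)$ is the graph obtained from $G$ by identifying, for each $j\in\{1,\dots,r\}$, all vertices in $\{u_i:i\in P_j\}$ into one vertex (edges are kept, so edges between identified vertices become loops); $H(\mathbf P)$ is defined analogously with the $v_i$. For vertex-disjoint graphs $G,W$ with $u_1,\dots,u_k\in V(G)$, $w_1,\dots,w_k\in V(W)$, $G(u_1,\dots,u_k)\sqcup W(w_1,\dots,w_k)$ is obtained from $G$ and $W$ by identifying $u_i$ with $w_i$ for every $i$. -}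

module Defs where

open import Data.Nat as ℕ using (ℕ; zero; suc; _∸_; _<ᵇ_)
open import Data.Nat.Combinatorics using (_C_)
open import Data.Fin as Fin using (Fin; toℕ; _↑ˡ_; _↑ʳ_)
open import Data.Bool using (Bool; true; false; _∧_; _∨_; not; if_then_else_)
open import Data.List using (List; []; _∷_; map; _++_; foldr; allFin; length)
open import Data.Bool.ListAction using (any)
open import Data.Maybe using (Maybe; just; nothing)
open import Data.Product using (_×_; _,_; proj₁; proj₂; Σ)
open import Data.Integer as ℤ using (ℤ)
open import Relation.Nullary.Decidable using (⌊_⌋)
open import Function using (id; _∘_)
open import Relation.Binary.PropositionalEquality using (_≡_)

-- Finite multigraphs (loops and parallel edges allowed).
-- Vertices are Fin n; edges form a list of (ordered, but read as
-- unordered) pairs of endpoints, so repeated entries = parallel edges,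
-- pairs (a , a) = loops.

record Graph : Set where
  field
    n : ℕ
    E : List (Fin n × Fin n)
open Graph public

_==_ : {m : ℕ} → Fin m → Fin m → Bool
x == y = ⌊ x Fin.≟ y ⌋

anyFin : (m : ℕ) → (Fin m → Bool) → Bool
anyFin m f = any f (allFin m)

countFin : (m : ℕ) → (Fin m → Bool) → ℕ
countFin m f = foldr (λ x acc → if f x then suc acc else acc) 0 (allFin m)

step : {m : ℕ} → List (Fin m × Fin m) → (Fin m → Bool) → (Fin m → Bool)
step A S v = S v ∨ any (λ e → (S (proj₁ e) ∧ (proj₂ e == v)) ∨ (S (proj₂ e) ∧ (proj₁ e == v))) A

iter : {X : Set} → ℕ → (X → X) → X → X
iter zero f x = x
iter (suc t) f x = f (iter t f x)

-- connected x y  iff  y is reachable from x in (Fin m , A)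
-- (m rounds of breadth-first expansion suffice)
connected : {m : ℕ} → List (Fin m × Fin m) → Fin m → Fin m → Bool
connected {m} A x = iter m (step A) (x ==_)

-- c(A): number of components of (V , A) = number of vertices that are the
-- least vertex of their component
components : (G : Graph) → List (Fin (n G) × Fin (n G)) → ℕ
components G A =
  countFin (n G) (λ v → not (anyFin (n G) (λ w → (toℕ w <ᵇ toℕ v) ∧ connected A w v)))

rank : (G : Graph) → List (Fin (n G) × Fin (n G)) → ℕ
rank G A = n G ∸ components G A

sublists : {X : Set} → List X → List (List X)
sublists [] = [] ∷ []
sublists (x ∷ xs) = map (x ∷_) (sublists xs) ++ sublists xs

-- Tutte polynomial, represented by its coefficient function:
-- tutte G i j = coefficient of x^i y^j in
--   T_G(x,y) = Σ_{A ⊆ E} (x-1)^{r(E)-r(A)} (y-1)^{|A|-r(A)} ,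
-- using  coeff of x^i in (x-1)^a = (a choose i) (-1)^(a-i).

signPow : ℕ → ℤ
signPow zero = ℤ.+ 1
signPow (suc t) = ℤ.- signPow t

coeffPow : ℕ → ℕ → ℤ
coeffPow a i = ℤ.+ (a C i) ℤ.* signPow (a ∸ i)

tutte : Graph → ℕ → ℕ → ℤ
tutte G i j =
  foldr ℤ._+_ (ℤ.+ 0)
    (map (λ A → coeffPow (rank G (E G) ∸ rank G A) i
                ℤ.* coeffPow (length A ∸ rank G A) j)
         (sublists (E G)))

TEquiv : Graph → Graph → Set
TEquiv G H = (i j : ℕ) → tutte G i j ≡ tutte H i j

Connected : Graph → Set
Connected G = components G (E G) ≡ 1

-- Quotient of a graph by an equivalence relation on its vertices
-- (given as a Boolean-valued relation `same`): every class is merged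
-- into one vertex, edges are kept (edges inside a class become loops).
-- The classes are numbered 0 .. (#classes - 1) in order of their least
-- element.

module _ {m : ℕ} (same : Fin m → Fin m → Bool) where

  firstTrue : (Fin m → Bool) → Maybe (Fin m)
  firstTrue f = foldr (λ w acc → if f w then just w else acc) nothing (allFin m)

  rep : Fin m → Fin m
  rep v with firstTrue (same v)
  ... | just w = w
  ... | nothing = v

  isRep : Fin m → Bool
  isRep v = rep v == v

  classCount : ℕ
  classCount = countFin m isRep

  classIndex : Fin m → ℕ
  classIndex v = countFin m (λ w → isRep w ∧ (toℕ w <ᵇ toℕ (rep v)))

clamp : (m : ℕ) → ℕ → Fin (suc m)
clamp zero _ = Fin.zero
clamp (suc m) zero = Fin.zero
clamp (suc m) (suc x) = Fin.suc (clamp m x)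

-- number of vertices of the quotient and the quotient map
-- (for m ≥ 1 there is always at least one class, so suc (classCount ∸ 1)
-- equals classCount)
quotientMap : (m : ℕ) → (Fin m → Fin m → Bool) → Σ ℕ (λ q → Fin m → Fin q)
quotientMap zero same = 0 , λ ()
quotientMap (suc m) same =
  suc (classCount same ∸ 1) , λ v → clamp (classCount same ∸ 1) (classIndex same v)

quotient : (G : Graph) → (Fin (n G) → Fin (n G) → Bool) → Graph
quotient G same = record
  { n = proj₁ (quotientMap (n G) same)
  ; E = map (λ e → f (proj₁ e) , f (proj₂ e)) (E G) }
  where f = proj₂ (quotientMap (n G) same)

-- G(P): a partition P of {1..k} is given by a block-labelling
-- p : Fin k → Fin k (i , j in the same block iff p i ≡ p j); every
-- partition of a k-set arises this way.  The vertices u_i, i ∈ P_j, are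
-- identified.  (For injective u this relation is an equivalence.)

identify : (G : Graph) {k : ℕ} → (Fin k → Fin (n G)) → (Fin k → Fin k) → Graph
identify G {k} u p = quotient G same
  where
  same : Fin (n G) → Fin (n G) → Bool
  same x y = (x == y) ∨ anyFin k (λ i → anyFin k (λ j →
               (u i == x) ∧ (u j == y) ∧ (p i == p j)))

disjointUnion : Graph → Graph → Graph
disjointUnion G W = record
  { n = n G ℕ.+ n W
  ; E = map (λ e → (proj₁ e ↑ˡ n W) , (proj₂ e ↑ˡ n W)) (E G)
     ++ map (λ e → (n G ↑ʳ proj₁ e) , (n G ↑ʳ proj₂ e)) (E W) }

glue : (G : Graph) (W : Graph) {k : ℕ} → (Fin k → Fin (n G)) → (Fin k → Fin (n W)) → Graph
glue G W {k} u w = quotient (disjointUnion G W) same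
  where
  same : Fin (n G ℕ.+ n W) → Fin (n G ℕ.+ n W) → Bool
  same x y = (x == y) ∨ anyFin k (λ i →
               ((x == (u i ↑ˡ n W)) ∧ (y == (n G ↑ʳ w i)))
             ∨ ((y == (u i ↑ˡ n W)) ∧ (x == (n G ↑ʳ w i))))

{-# OPTIONS --safe #-}
module Submission where

-- For B ⊆ E(W) let P_B be the partition of the terminals in which i and j share a block iff w_i and
-- w_j are joined by B.  Adding the edges of A ⊆ E(G) one at a time shows
--   r_{G ⊔ W}(A ∪ B) = r_{G(P_B)}(A) + r_W(B).
-- Hence T_{G ⊔ W} = Σ_B (x − 1)^{b(B)} (y − 1)^{|B| − r_W(B)} T_{G(P_B)}, where
-- b(B) = r_{G(P_E)}(E(G)) − r_{G(P_B)}(E(G)) + r_W(E(W)) − r_W(B) and P_E is the partition for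
-- B = E(W).  As G is connected, r_{G(P)}(E(G)) = r_G(E(G)) − (k − |P|), so b(B) does not depend
-- on G, and the sum depends on G only through the polynomials T_{G(P)}.

open import Defs
open import Data.Bool using (Bool; true; false; _∧_; _∨_; not; if_then_else_)
import Data.Bool as Bool
open import Data.Bool.ListAction using (any)
open import Data.Bool.Properties using (¬-not)
open import Data.Fin using (Fin; zero; suc; toℕ; splitAt; _↑ˡ_; _↑ʳ_)
import Data.Fin as Fin
import Data.Fin.Properties as Fin
open import Data.Integer using (ℤ; -_) renaming (_+_ to _+ℤ_; _*_ to _*ℤ_; _-_ to _-ℤ_)
import Data.Integer as ℤ
import Data.Integer.Properties as ℤ
import Data.Integer.Solver as ℤ-Solver
open import Data.List using (List; []; _∷_; map; _++_; foldr; allFin; length; tabulate; filter; cartesianProduct)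
open import Data.List.Membership.Propositional using (_∈_; find)
open import Data.List.Membership.Propositional.Properties using (∈-map⁺; ∈-map⁻; ∈-++⁺ˡ; ∈-++⁺ʳ; ∈-++⁻; ∈-filter⁺; ∈-filter⁻; ∈-allFin; ∈-cartesianProduct⁺)
open import Data.List.Properties using (map-id; map-++; map-∘; length-++; length-map)
open import Data.List.Relation.Binary.Subset.Propositional using (_⊆_)
open import Data.List.Relation.Binary.Subset.Propositional.Properties using (map⁺; ++⁺; ⊆-refl; ∷⁺ʳ)
open import Data.List.Relation.Unary.Any as Any using (Any; here; there)
import Data.List.Relation.Unary.Any.Properties as Any
open import Data.Maybe using (Maybe; just; nothing)
open import Data.Nat using (ℕ; zero; suc; _+_; _∸_; _≤_; _<_; _<ᵇ_; z≤n; s≤s)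
open import Data.Nat.Combinatorics using (_C_; k>n⇒nCk≡0; nCk+nC[k+1]≡[n+1]C[k+1]; nCk≡nC[n∸k]; nCn≡1)
open import Data.Nat.Properties
import Data.Nat.Solver as ℕ-Solver
open import Data.Product using (_×_; _,_; proj₁; proj₂; ∃)
open import Data.Sum using (_⊎_; inj₁; inj₂; [_,_]′; swap)
open import Function using (id; _∘_)
open import Function.Definitions using (Injective)
open import Relation.Binary using (IsEquivalence; tri<; tri≈; tri>)
open import Relation.Binary.Construct.Closure.Equivalence as Eq using (EqClosure)
open import Relation.Binary.Construct.Closure.ReflexiveTransitive using (ε; _◅_; _◅◅_)
open import Relation.Binary.Construct.Closure.Symmetric using (fwd; bwd)
import Relation.Binary.Construct.On as On
open import Relation.Binary.PropositionalEquality
open import Relation.Nullary using (¬_; Dec; yes; no; contradiction; Reflects; ofʸ; ofⁿ; _because_)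
open import Relation.Nullary.Decidable using (_×-dec_)
open import Relation.Nullary.Reflects using (¬-reflects; _×-reflects_; _⊎-reflects_)

-- T-equivalence equates coefficients of whole sums and matches no edge set of G with one of H. The
-- factor (x - 1)^b (y - 1)^d must therefore be the same for both graphs, and multiplication by it
-- has to be carried out on coefficient functions. The exponent b(B) involves two partitions because
-- the full rank of the glued graph belongs to B = E(W), while the summand belongs to B. Vertices of
-- quotients are never counted directly. Identification is traded for extra edges: joining all
-- members of each block in G has the same effect on connectivity as merging them, and costs a rank
-- that depends on the partition alone. Both this and the gluing formula then reduce to one
-- comparison, namely whether a new edge has its ends already connected on either side. Subtraction
-- on ℕ truncates, so every exponent identity comes with inequalities which show that the
-- differences are genuine.

private
  variable
    m q : ℕ
    P Q : Set
    a b : Bool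

-- Boolean reflection

reflects-map : (P → Q) → (Q → P) → Reflects P a → Reflects Q a
reflects-map f g (ofʸ p) = ofʸ (f p)
reflects-map f g (ofⁿ ¬p) = ofⁿ (¬p ∘ g)

reflects⇒true : Reflects P a → P → a ≡ true
reflects⇒true (ofʸ _) p = refl
reflects⇒true (ofⁿ ¬p) p = contradiction p ¬p

reflects⇒false : Reflects P a → ¬ P → a ≡ false
reflects⇒false (ofʸ p) ¬p = contradiction p ¬p
reflects⇒false (ofⁿ _) ¬p = refl

true⇒holds : Reflects P a → a ≡ true → P
true⇒holds (ofʸ p) refl = p

reflects-≡ : Reflects P a → Reflects Q b → (P → Q) → (Q → P) → a ≡ b
reflects-≡ (ofʸ p) r f g = sym (reflects⇒true r (f p))
reflects-≡ (ofⁿ ¬p) r f g = sym (reflects⇒false r (¬p ∘ g))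

≡true-reflects : ∀ b → Reflects (b ≡ true) b
≡true-reflects true = ofʸ refl
≡true-reflects false = ofⁿ λ ()

==-reflects : (x y : Fin m) → Reflects (x ≡ y) (x == y)
==-reflects x y with x Fin.≟ y
... | yes p = ofʸ p
... | no ¬p = ofⁿ ¬p

any-reflects : {X : Set} {P : X → Set} {f : X → Bool} → (∀ x → Reflects (P x) (f x)) →
  ∀ xs → Reflects (Any P xs) (any f xs)
any-reflects r [] = ofⁿ λ ()
any-reflects r (x ∷ xs) =
  reflects-map Any.fromSum Any.toSum (r x ⊎-reflects any-reflects r xs)

anyFin-reflects : {P : Fin m → Set} {f : Fin m → Bool} → (∀ x → Reflects (P x) (f x)) →
  Reflects (∃ P) (anyFin m f)
anyFin-reflects {m} r =
  reflects-map Any.tabulate⁻ (λ (x , p) → Any.tabulate⁺ x p) (any-reflects r (allFin m))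

-- Counting

-- The tail of `allFin (suc m)` is `tabulate suc`, not `allFin m`; induction needs an arbitrary `g`.
countFin-tabulate : ∀ m (f : Fin q → Bool) (g : Fin m → Fin q) →
  foldr (λ x acc → if f x then suc acc else acc) 0 (tabulate g) ≡ countFin m (f ∘ g)
countFin-tabulate zero f g = refl
countFin-tabulate (suc m) f g with f (g zero)
... | true = cong suc (trans (countFin-tabulate m f (g ∘ suc)) (sym (countFin-tabulate m (f ∘ g) suc)))
... | false = trans (countFin-tabulate m f (g ∘ suc)) (sym (countFin-tabulate m (f ∘ g) suc))

countFin-suc : ∀ m (f : Fin (suc m) → Bool) →
  countFin (suc m) f ≡ (if f zero then suc (countFin m (f ∘ suc)) else countFin m (f ∘ suc))
countFin-suc m f rewrite countFin-tabulate m f suc = refl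

countFin-mono : ∀ m {f g : Fin m → Bool} → (∀ x → f x ≡ true → g x ≡ true) → countFin m f ≤ countFin m g
countFin-mono zero h = z≤n
countFin-mono (suc m) {f} {g} h rewrite countFin-suc m f | countFin-suc m g
  with f zero in p | g zero in r | countFin-mono m (h ∘ suc)
... | true | true | ih = s≤s ih
... | true | false | ih = contradiction (trans (sym r) (h zero p)) λ ()
... | false | true | ih = m≤n⇒m≤1+n ih
... | false | false | ih = ih

countFin-cong : ∀ m {f g : Fin m → Bool} → (∀ x → f x ≡ g x) → countFin m f ≡ countFin m g
countFin-cong m h = ≤-antisym
  (countFin-mono m λ x → trans (sym (h x))) (countFin-mono m λ x → trans (h x))

countFin-remove : ∀ m {f g : Fin m → Bool} y → f y ≡ false → g y ≡ true →
  (∀ x → x ≢ y → f x ≡ g x) → countFin m g ≡ suc (countFin m f)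
countFin-remove (suc m) {f} {g} zero fy gy h
  rewrite countFin-suc m f | countFin-suc m g | fy | gy =
  cong suc (countFin-cong m λ x → sym (h (suc x) λ ()))
countFin-remove (suc m) {f} {g} (suc y) fy gy h
  rewrite countFin-suc m f | countFin-suc m g | h zero (λ ())
        | countFin-remove m y fy gy (λ x x≢y → h (suc x) (x≢y ∘ Fin.suc-injective))
  with g zero
... | true = refl
... | false = refl

countFin-mono-< : ∀ m {f g : Fin m → Bool} y → f y ≡ false → g y ≡ true →
  (∀ x → f x ≡ true → g x ≡ true) → countFin m f < countFin m g
countFin-mono-< (suc m) {f} {g} zero fy gy h
  rewrite countFin-suc m f | countFin-suc m g | fy | gy = s≤s (countFin-mono m (h ∘ suc))
countFin-mono-< (suc m) {f} {g} (suc y) fy gy h rewrite countFin-suc m f | countFin-suc m g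
  with f zero in p | g zero in r | countFin-mono-< m y fy gy (h ∘ suc)
... | true | true | ih = s≤s ih
... | true | false | ih = contradiction (trans (sym r) (h zero p)) λ ()
... | false | true | ih = m≤n⇒m≤1+n ih
... | false | false | ih = ih

countFin-positive : ∀ m {f : Fin m → Bool} y → f y ≡ true → 0 < countFin m f
countFin-positive m y fy = ≤-trans (s≤s z≤n) (countFin-mono-< m {λ _ → false} y refl fy λ _ ())

countFin-true : ∀ m → countFin m (λ _ → true) ≡ m
countFin-true zero = refl
countFin-true (suc m) = trans (countFin-suc m (λ _ → true)) (cong suc (countFin-true m))

countFin≤ : ∀ m (f : Fin m → Bool) → countFin m f ≤ m
countFin≤ m f = subst (countFin m f ≤_) (countFin-true m) (countFin-mono m λ _ _ → refl)

-- Least representatives and the quotient map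

First : (Fin m → Fin q) → (Fin q → Bool) → Maybe (Fin q) → Set
First g f nothing = ∀ x → f (g x) ≡ false
First g f (just w) = ∃ λ x → w ≡ g x × f (g x) ≡ true × (∀ y → y Fin.< x → f (g y) ≡ false)

first-tabulate : ∀ m (g : Fin m → Fin q) (f : Fin q → Bool) →
  First g f (foldr (λ w acc → if f w then just w else acc) nothing (tabulate g))
first-tabulate zero g f = λ ()
first-tabulate (suc m) g f with f (g zero) in p
... | true = zero , refl , p , λ _ ()
... | false with foldr (λ w acc → if f w then just w else acc) nothing (tabulate (g ∘ suc))
               | first-tabulate m (g ∘ suc) f
...   | nothing | h = λ { zero → p ; (suc x) → h x }
...   | just w | x , eq , fx , min =
        suc x , eq , fx , λ { zero _ → p ; (suc y) (s≤s y<x) → min y y<x }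

clamp-toℕ : ∀ m x → x ≤ m → toℕ (clamp m x) ≡ x
clamp-toℕ zero zero _ = refl
clamp-toℕ (suc m) zero _ = refl
clamp-toℕ (suc m) (suc x) (s≤s x≤m) = cong suc (clamp-toℕ m x x≤m)

module Quotient {m : ℕ} {_≈_ : Fin m → Fin m → Set} (isEq : IsEquivalence _≈_)
                {same : Fin m → Fin m → Bool}
                (reflects : ∀ x y → Reflects (x ≈ y) (same x y)) where
  open IsEquivalence isEq renaming (refl to ≈-refl; sym to ≈-sym; trans to ≈-trans)

  rep-spec : ∀ v → v ≈ rep same v × (∀ w → v ≈ w → ¬ (w Fin.< rep same v))
  rep-spec v with firstTrue same (same v) | first-tabulate m id (same v)
  ... | nothing | none = contradiction (trans (sym (none v)) (reflects⇒true (reflects v v) ≈-refl)) λ ()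
  ... | just w | .w , refl , vw , min =
    true⇒holds (reflects v w) vw ,
    λ y v≈y y<w → contradiction (trans (sym (min y y<w)) (reflects⇒true (reflects v y) v≈y)) λ ()

  rep-≈ : ∀ v → v ≈ rep same v
  rep-≈ v = proj₁ (rep-spec v)

  rep-least : ∀ {v w} → v ≈ w → ¬ (w Fin.< rep same v)
  rep-least {v} {w} = proj₂ (rep-spec v) w

  rep-cong : ∀ {v w} → v ≈ w → rep same v ≡ rep same w
  rep-cong {v} {w} v≈w with Fin.<-cmp (rep same v) (rep same w)
  ... | tri< lt _ _ = contradiction lt (rep-least (≈-trans (≈-sym v≈w) (rep-≈ v)))
  ... | tri≈ _ eq _ = eq
  ... | tri> _ _ gt = contradiction gt (rep-least (≈-trans v≈w (rep-≈ w)))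

  rep-injective : ∀ {v w} → rep same v ≡ rep same w → v ≈ w
  rep-injective {v} {w} eq = ≈-trans (rep-≈ v) (subst (_≈ w) (sym eq) (≈-sym (rep-≈ w)))

  isRep-rep : ∀ v → isRep same (rep same v) ≡ true
  isRep-rep v = reflects⇒true (==-reflects _ _) (sym (rep-cong (rep-≈ v)))

  private
    below : Fin m → Fin m → Bool
    below v w = isRep same w ∧ (toℕ w <ᵇ toℕ (rep same v))

    below-reflects : ∀ v w → Reflects (isRep same w ≡ true × w Fin.< rep same v) (below v w)
    below-reflects v w = ≡true-reflects _ ×-reflects <ᵇ-reflects-< _ _

  -- The representative of `v` is itself counted by `classCount` but is not below itself, hence
  -- strictness.
  classIndex<classCount : ∀ v → classIndex same v < classCount same
  classIndex<classCount v = countFin-mono-< m (rep same v)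
    (reflects⇒false (below-reflects v _) (n≮n _ ∘ proj₂)) (isRep-rep v)
    (λ x → proj₁ ∘ true⇒holds (below-reflects v x))

  classIndex-mono-< : ∀ v w → rep same v Fin.< rep same w → classIndex same v < classIndex same w
  classIndex-mono-< v w lt = countFin-mono-< m (rep same v)
    (reflects⇒false (below-reflects v _) (n≮n _ ∘ proj₂))
    (reflects⇒true (below-reflects w _) (isRep-rep v , lt))
    (λ x bx → let r , x<v = true⇒holds (below-reflects v x) bx
              in reflects⇒true (below-reflects w x) (r , <-trans x<v lt))

  classIndex-injective : ∀ v w → classIndex same v ≡ classIndex same w → v ≈ w
  classIndex-injective v w eq with Fin.<-cmp (rep same v) (rep same w)
  ... | tri< lt _ _ = contradiction (classIndex-mono-< v w lt) (n≮n _ ∘ subst (_< _) eq)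
  ... | tri≈ _ e _ = rep-injective e
  ... | tri> _ _ gt = contradiction (classIndex-mono-< w v gt) (n≮n _ ∘ subst (_ <_) eq)

  classIndex-cong : ∀ {v w} → v ≈ w → classIndex same v ≡ classIndex same w
  classIndex-cong v≈w =
    cong (λ r → countFin m (λ x → isRep same x ∧ (toℕ x <ᵇ toℕ r))) (rep-cong v≈w)

quotientMap-injective : ∀ m {_≈_ : Fin m → Fin m → Set} → IsEquivalence _≈_ →
  {same : Fin m → Fin m → Bool} → (∀ x y → Reflects (x ≈ y) (same x y)) → ∀ {x y} →
  proj₂ (quotientMap m same) x ≡ proj₂ (quotientMap m same) y → x ≈ y
quotientMap-injective (suc m) isEq {same} r {x} {y} eq =
  classIndex-injective x y (trans (sym (toℕ-index x)) (trans (cong toℕ eq) (toℕ-index y)))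
  where
  open Quotient isEq r
  -- `clamp` saturates at `classCount same ∸ 1`; class indices are strictly below the number of
  -- classes, so none is altered.
  toℕ-index : ∀ v → toℕ (proj₂ (quotientMap (suc m) same) v) ≡ classIndex same v
  toℕ-index v = clamp-toℕ _ _ (<⇒≤pred (classIndex<classCount v))

quotientMap-cong : ∀ m {_≈_ : Fin m → Fin m → Set} → IsEquivalence _≈_ →
  {same : Fin m → Fin m → Bool} → (∀ x y → Reflects (x ≈ y) (same x y)) → ∀ {x y} →
  x ≈ y → proj₂ (quotientMap m same) x ≡ proj₂ (quotientMap m same) y
quotientMap-cong (suc m) isEq r x≈y = cong (clamp _) (Quotient.classIndex-cong isEq r x≈y)

-- Connectivity

Edges : ℕ → Set
Edges m = List (Fin m × Fin m)

-- The equivalence closure forgets the orientation of the stored pairs; an inhabitant is a walk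
-- whose `fwd` and `bwd` steps tell which way each edge is crossed.
Conn : Edges m → Fin m → Fin m → Set
Conn A = EqClosure λ x y → (x , y) ∈ A

conn-sym : {A : Edges m} → ∀ {x y} → Conn A x y → Conn A y x
conn-sym = Eq.symmetric _

conn-edge : {A : Edges m} → ∀ {x y} → (x , y) ∈ A → Conn A x y
conn-edge = Eq.return

conn-mono : {A B : Edges m} → A ⊆ B → ∀ {x y} → Conn A x y → Conn B x y
conn-mono A⊆B = Eq.map A⊆B

Reach : Edges m → (Fin m → Bool) → Fin m → Set
Reach A S v = S v ≡ true ⊎
  Any (λ e → (S (proj₁ e) ≡ true × proj₂ e ≡ v) ⊎ (S (proj₂ e) ≡ true × proj₁ e ≡ v)) A

step-reflects : (A : Edges m) (S : Fin m → Bool) → ∀ v → Reflects (Reach A S v) (step A S v)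
step-reflects A S v = ≡true-reflects (S v) ⊎-reflects any-reflects
  (λ e → (≡true-reflects (S (proj₁ e)) ×-reflects ==-reflects (proj₂ e) v)
           ⊎-reflects (≡true-reflects (S (proj₂ e)) ×-reflects ==-reflects (proj₁ e) v)) A

module BreadthFirst {m : ℕ} (A : Edges m) (x : Fin m) where

  ball : ℕ → Fin m → Bool
  ball t = iter t (step A) (x ==_)

  Closed : (Fin m → Bool) → Set
  Closed S = ∀ v → step A S v ≡ true → S v ≡ true

  ball-mono : ∀ t v → ball t v ≡ true → ball (suc t) v ≡ true
  ball-mono t v h = reflects⇒true (step-reflects A (ball t) v) (inj₁ h)

  source-in-ball : ∀ t → ball t x ≡ true
  source-in-ball zero = reflects⇒true (==-reflects x x) refl
  source-in-ball (suc t) = ball-mono t x (source-in-ball t)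

  ball-sound : ∀ t v → ball t v ≡ true → Conn A x v
  ball-sound zero v h with refl ← true⇒holds (==-reflects x v) h = ε
  ball-sound (suc t) v h with true⇒holds (step-reflects A (ball t) v) h
  ... | inj₁ h′ = ball-sound t v h′
  ... | inj₂ h′ with find h′
  ...   | (a , .v) , e , inj₁ (r , refl) = ball-sound t a r ◅◅ conn-edge e
  ...   | (.v , b) , e , inj₂ (r , refl) = ball-sound t b r ◅◅ conn-sym (conn-edge e)

  step-closed : ∀ {S} → Closed S → Closed (step A S)
  step-closed {S} cl v h with true⇒holds (step-reflects A (step A S) v) h
  ... | inj₁ p = p
  ... | inj₂ p = reflects⇒true (step-reflects A S v) (inj₂ (Any.map
    [ (λ (s , e) → inj₁ (cl _ s , e)) , (λ (s , e) → inj₂ (cl _ s , e)) ]′ p))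

  -- A round that does not stabilise the ball adds a vertex. After `m` rounds the second alternative
  -- would give more than `m` vertices, which is why `m` rounds suffice.
  closed-or-large : ∀ t → Closed (ball t) ⊎ t < countFin m (ball t)
  closed-or-large zero = inj₂ (countFin-positive m x (source-in-ball 0))
  closed-or-large (suc t) with closed-or-large t
  ... | inj₁ cl = inj₁ (step-closed cl)
  ... | inj₂ large with Fin.any? (λ v → ball t v Bool.≟ false ×-dec ball (suc t) v Bool.≟ true)
  ...   | yes (v , out , in′) =
          inj₂ (≤-trans (s≤s large) (countFin-mono-< m v out in′ (ball-mono t)))
  ...   | no none = inj₁ (step-closed closed)
    where
    closed : Closed (ball t)
    closed v h with ball t v Bool.≟ true
    ... | yes p = p
    ... | no ¬p = contradiction (v , ¬-not ¬p , h) none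

  ball-closed : Closed (ball m)
  ball-closed with closed-or-large m
  ... | inj₁ cl = cl
  ... | inj₂ large = contradiction (≤-trans large (countFin≤ m _)) (n≮n m)

  closed⇒reach : ∀ {S} → Closed S → ∀ {v w} → S v ≡ true → Conn A v w → S w ≡ true
  closed⇒reach cl h ε = h
  closed⇒reach {S} cl h (fwd e ◅ p) = closed⇒reach cl
    (cl _ (reflects⇒true (step-reflects A S _) (inj₂ (Any.map (λ { refl → inj₁ (h , refl) }) e)))) p
  closed⇒reach {S} cl h (bwd e ◅ p) = closed⇒reach cl
    (cl _ (reflects⇒true (step-reflects A S _) (inj₂ (Any.map (λ { refl → inj₂ (h , refl) }) e)))) p

conn-reflects : (A : Edges m) → ∀ x y → Reflects (Conn A x y) (connected A x y)
conn-reflects {m} A x y = reflects-map (ball-sound m y)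
  (closed⇒reach ball-closed (source-in-ball m)) (≡true-reflects _)
  where open BreadthFirst A x

conn-dec : (A : Edges m) → ∀ x y → Dec (Conn A x y)
conn-dec A x y = connected A x y because conn-reflects A x y

-- Components and rank

Leader : Edges m → Fin m → Set
Leader A v = ∀ w → w Fin.< v → ¬ Conn A w v

isLeader : Edges m → Fin m → Bool
isLeader {m} A v = not (anyFin m (λ w → (toℕ w <ᵇ toℕ v) ∧ connected A w v))

isLeader-reflects : (A : Edges m) → ∀ v → Reflects (Leader A v) (isLeader A v)
isLeader-reflects A v = reflects-map
  (λ none w w<v c → none (w , w<v , c)) (λ lead (w , w<v , c) → lead w w<v c)
  (¬-reflects (anyFin-reflects λ w → <ᵇ-reflects-< (toℕ w) (toℕ v) ×-reflects conn-reflects A w v))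

leader-unique : {A : Edges m} → ∀ {v w} → Leader A v → Leader A w → Conn A v w → v ≡ w
leader-unique {v = v} {w} lv lw c with Fin.<-cmp v w
... | tri< lt _ _ = contradiction c (lw v lt)
... | tri≈ _ eq _ = eq
... | tri> _ _ gt = contradiction (conn-sym c) (lv w gt)

leader-of : (A : Edges m) → ∀ x → ∃ λ r → Conn A x r × Leader A r
leader-of A x = rep (connected A) x , rep-≈ x ,
  λ w w<r c → rep-least (rep-≈ x ◅◅ conn-sym c) w<r
  where open Quotient (Eq.isEquivalence _) (conn-reflects A)

-- Unfolds to `components G A` for every `G` on `m` vertices, so facts about leaders serve as facts
-- about components without conversion.
leaders : Edges m → ℕ
leaders {m} A = countFin m (isLeader A)

-- Phrased with connectivity instead of inclusion of edge lists, so that it also applies to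
-- `conn-absorb`, where the list shrinks.
leaders-antitone : {A B : Edges m} → (∀ {x y} → Conn A x y → Conn B x y) → leaders B ≤ leaders A
leaders-antitone {A = A} {B} A⇒B = countFin-mono _ λ v lead →
  reflects⇒true (isLeader-reflects A v)
    (λ w w<v c → true⇒holds (isLeader-reflects B v) lead w w<v (A⇒B c))

leaders-[] : leaders {m} [] ≡ m
leaders-[] {m} = trans
  (countFin-cong m λ v → reflects⇒true (isLeader-reflects [] v)
    λ { w w<v ε → n≮n _ w<v ; _ _ (fwd () ◅ _) ; _ _ (bwd () ◅ _) })
  (countFin-true m)

leaders-positive : (A : Edges (suc m)) → 0 < leaders A
leaders-positive {m} A = countFin-positive (suc m) zero (reflects⇒true (isLeader-reflects A zero) λ _ ())

Merged : Edges m → Fin m → Fin m → Fin m → Fin m → Set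
Merged A a b x y = Conn A x y ⊎ (Conn A x a × Conn A b y) ⊎ (Conn A x b × Conn A a y)

-- If the walk starts with the new edge, whatever the rest does up to its own crossing is dropped;
-- so one crossing at most remains.
conn-∷⁻ : {A : Edges m} → ∀ {a b x y} → Conn ((a , b) ∷ A) x y → Merged A a b x y
conn-∷⁻ ε = inj₁ ε
conn-∷⁻ (fwd (here refl) ◅ p) with conn-∷⁻ p
... | inj₁ by = inj₂ (inj₁ (ε , by))
... | inj₂ (inj₁ (_ , by)) = inj₂ (inj₁ (ε , by))
... | inj₂ (inj₂ (_ , ay)) = inj₁ ay
conn-∷⁻ (bwd (here refl) ◅ p) with conn-∷⁻ p
... | inj₁ ay = inj₂ (inj₂ (ε , ay))
... | inj₂ (inj₁ (_ , by)) = inj₁ by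
... | inj₂ (inj₂ (_ , ay)) = inj₂ (inj₂ (ε , ay))
conn-∷⁻ (fwd (there e) ◅ p) with conn-∷⁻ p
... | inj₁ c = inj₁ (fwd e ◅ c)
... | inj₂ (inj₁ (c , d)) = inj₂ (inj₁ (fwd e ◅ c , d))
... | inj₂ (inj₂ (c , d)) = inj₂ (inj₂ (fwd e ◅ c , d))
conn-∷⁻ (bwd (there e) ◅ p) with conn-∷⁻ p
... | inj₁ c = inj₁ (bwd e ◅ c)
... | inj₂ (inj₁ (c , d)) = inj₂ (inj₁ (bwd e ◅ c , d))
... | inj₂ (inj₂ (c , d)) = inj₂ (inj₂ (bwd e ◅ c , d))

-- Merging the components with leaders r < s turns exactly s into a non-leader.
leaders-merge : {A A′ : Edges m} → ∀ {a b r s} →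
  (∀ {x y} → Conn A x y → Conn A′ x y) → Conn A′ a b → (∀ {x y} → Conn A′ x y → Merged A a b x y) →
  Conn A a r → Leader A r → Conn A b s → Leader A s → r Fin.< s →
  leaders A ≡ suc (leaders A′)
leaders-merge {A = A} {A′} {a} {b} {r} {s} up ab down ar lr bs ls r<s =
  countFin-remove _ s
    (reflects⇒false (isLeader-reflects A′ s) λ l → l r r<s (up (conn-sym ar) ◅◅ ab ◅◅ up bs))
    (reflects⇒true (isLeader-reflects A s) ls)
    λ x x≢s → reflects-≡ (isLeader-reflects A′ x) (isLeader-reflects A x)
      (λ l w w<x c → l w w<x (up c))
      (λ l w w<x c → impossible x≢s l w<x (down c))
  where
  impossible : ∀ {x w} → x ≢ s → Leader A x → w Fin.< x → ¬ Merged A a b w x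
  impossible x≢s l w<x (inj₁ wx) = l _ w<x wx
  impossible x≢s l w<x (inj₂ (inj₁ (wa , bx))) = x≢s (leader-unique l ls (conn-sym bx ◅◅ bs))
  -- Here `x` is `r`, and `w` would be a vertex of the component of `s` with `w < r < s`.
  impossible x≢s l w<x (inj₂ (inj₂ (wb , ax))) with refl ← leader-unique l lr (conn-sym ax ◅◅ ar) =
    ls _ (<-trans w<x r<s) (wb ◅◅ bs)

leaders-∷ : (A : Edges m) → ∀ {a b} → ¬ Conn A a b → leaders A ≡ suc (leaders ((a , b) ∷ A))
leaders-∷ A {a} {b} ¬ab with leader-of A a | leader-of A b
... | r , ar , lr | s , bs , ls with Fin.<-cmp r s
...   | tri< r<s _ _ = leaders-merge (conn-mono there) (conn-edge (here refl)) conn-∷⁻ ar lr bs ls r<s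
...   | tri≈ _ refl _ = contradiction (ar ◅◅ conn-sym bs) ¬ab
...   | tri> _ _ s<r = leaders-merge (conn-mono there) (conn-sym (conn-edge (here refl)))
          ([ inj₁ , inj₂ ∘ swap ]′ ∘ conn-∷⁻) bs ls ar lr s<r

conn-absorb : {A : Edges m} → ∀ {a b} → Conn A a b → ∀ {x y} → Conn ((a , b) ∷ A) x y → Conn A x y
conn-absorb ab = Eq.fold (Eq.isEquivalence _) λ { (here refl) → ab ; (there e) → conn-edge e }

module _ (G : Graph) where

  rank-[] : rank G [] ≡ 0
  rank-[] = trans (cong (n G ∸_) (leaders-[] {n G})) (n∸n≡0 (n G))

  rank-mono : {A B : Edges (n G)} → A ⊆ B → rank G A ≤ rank G B
  rank-mono A⊆B = ∸-monoʳ-≤ (n G) (leaders-antitone (conn-mono A⊆B))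

  rank-∷-connected : (A : Edges (n G)) → ∀ {a b} → Conn A a b → rank G ((a , b) ∷ A) ≡ rank G A
  rank-∷-connected A ab = ≤-antisym
    (∸-monoʳ-≤ (n G) (leaders-antitone (conn-absorb ab))) (rank-mono {A} there)

  rank-∷-separated : (A : Edges (n G)) → ∀ {a b} → ¬ Conn A a b → rank G ((a , b) ∷ A) ≡ suc (rank G A)
  rank-∷-separated A {a} {b} ¬ab =
    -- The old count is one more than the new one and at most `n G`, so the truncated subtraction
    -- really gains 1.
    trans (+-∸-assoc 1 (subst (_≤ n G) (leaders-∷ A ¬ab) (countFin≤ (n G) (isLeader A))))
          (cong (λ c → suc (n G ∸ c)) (sym (leaders-∷ A ¬ab)))

  rank≤length : (A : Edges (n G)) → rank G A ≤ length A
  rank≤length [] = ≤-reflexive rank-[]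
  rank≤length ((a , b) ∷ A) with conn-dec A a b
  ... | yes ab = subst (_≤ suc (length A)) (sym (rank-∷-connected A ab)) (m≤n⇒m≤1+n (rank≤length A))
  ... | no ¬ab = subst (_≤ suc (length A)) (sym (rank-∷-separated A ¬ab)) (s≤s (rank≤length A))

-- Connectivity and rank under maps of vertices

mapEdges : (Fin m → Fin q) → Edges m → Edges q
mapEdges f = map λ e → f (proj₁ e) , f (proj₂ e)

conn-map : (f : Fin m → Fin q) {A : Edges m} → ∀ {x y} → Conn A x y → Conn (mapEdges f A) (f x) (f y)
conn-map f = Eq.gmap f (∈-map⁺ _)

-- Any vertex met by an edge of mapEdges f A lies in the image of f, so f need not be surjective.
conn-lift : {R : Fin m → Fin m → Set} → IsEquivalence R → (f : Fin m → Fin q) {A : Edges m} →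
  (∀ {x y} → f x ≡ f y → R x y) → (∀ {x y} → (x , y) ∈ A → R x y) →
  ∀ {x y} → Conn (mapEdges f A) (f x) (f y) → R x y
conn-lift {R = R} isEq f {A} fibre edge c = lift c refl refl
  where
  open IsEquivalence isEq using () renaming (sym to R-sym; trans to R-trans)
  lift : ∀ {p r} → Conn (mapEdges f A) p r → ∀ {x y} → p ≡ f x → r ≡ f y → R x y
  lift ε p≡ r≡ = fibre (trans (sym p≡) r≡)
  lift (fwd e ◅ c) p≡ r≡ with _ , e∈A , refl ← ∈-map⁻ _ e =
    R-trans (fibre (sym p≡)) (R-trans (edge e∈A) (lift c refl r≡))
  lift (bwd e ◅ c) p≡ r≡ with _ , e∈A , refl ← ∈-map⁻ _ e =
    R-trans (fibre (sym p≡)) (R-trans (R-sym (edge e∈A)) (lift c refl r≡))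

-- Added edge by edge: an edge joins two components in `X` exactly when its image does in `Y`.
-- Vertices of `Y` outside the image stay isolated and contribute no rank.
rank-embed : (X Y : Graph) (f : Fin (n X) → Fin (n Y)) → (∀ {x y} → f x ≡ f y → x ≡ y) →
  ∀ A → rank Y (mapEdges f A) ≡ rank X A
rank-embed X Y f f-inj [] = trans (rank-[] Y) (sym (rank-[] X))
rank-embed X Y f f-inj ((a , b) ∷ A) with conn-dec A a b
... | yes c = trans (rank-∷-connected Y (mapEdges f A) (conn-map f c))
  (trans (rank-embed X Y f f-inj A) (sym (rank-∷-connected X A c)))
... | no ¬c = trans (rank-∷-separated Y (mapEdges f A)
    (¬c ∘ conn-lift (Eq.isEquivalence _) f (λ eq → subst (Conn A _) (f-inj eq) ε) conn-edge))
  (trans (cong suc (rank-embed X Y f f-inj A)) (sym (rank-∷-separated X A ¬c)))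

-- As edges of A are added one at a time, both sides gain 1 for exactly the same edges.
rank-contract : (X Y : Graph) (f : Fin m → Fin (n X)) (g : Fin m → Fin (n Y)) (B : Edges (n X)) →
  (∀ A {x y} → Conn (mapEdges f A ++ B) (f x) (f y) → Conn (mapEdges g A) (g x) (g y)) →
  (∀ A {x y} → Conn (mapEdges g A) (g x) (g y) → Conn (mapEdges f A ++ B) (f x) (f y)) →
  ∀ A → rank X (mapEdges f A ++ B) ≡ rank Y (mapEdges g A) + rank X B
rank-contract X Y f g B to from [] = cong (_+ rank X B) (sym (rank-[] Y))
rank-contract X Y f g B to from ((a , b) ∷ A) with conn-dec (mapEdges f A ++ B) (f a) (f b)
... | yes c rewrite rank-∷-connected X (mapEdges f A ++ B) c
                  | rank-∷-connected Y (mapEdges g A) (to A c) = rank-contract X Y f g B to from A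
... | no ¬c rewrite rank-∷-separated X (mapEdges f A ++ B) ¬c
                  | rank-∷-separated Y (mapEdges g A) (¬c ∘ from A) =
  cong suc (rank-contract X Y f g B to from A)

-- One component is already the minimum, so adding `F` cannot lower the count any further.
rank-spanning : (G : Graph) → Connected G → ∀ F → rank G (E G ++ F) ≡ rank G (E G)
rank-spanning G conn F = cong (n G ∸_) (≤-antisym
  (leaders-antitone {A = E G} {B = E G ++ F} (conn-mono ∈-++⁺ˡ))
  (subst (_≤ leaders (E G ++ F)) (sym conn) (positive (n G) (E G) conn (E G ++ F))))
  where
  -- The equation `leaders A ≡ 1` excludes `m = 0`, where there is no leader.
  positive : ∀ m (A : Edges m) → leaders A ≡ 1 → (B : Edges m) → 0 < leaders B
  positive (suc m) _ _ B = leaders-positive B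

-- Identifying terminals

terminals : ℕ → Graph
terminals k = record { n = k ; E = [] }

-- A complete graph on each block, standing in for the identification of that block. All ordered
-- pairs are listed, loops included, so membership is exactly `p i ≡ p j`.
blockEdges : {k : ℕ} → (Fin k → Fin k) → Edges k
blockEdges {k} p = filter (λ e → p (proj₁ e) Fin.≟ p (proj₂ e)) (cartesianProduct (allFin k) (allFin k))

-- This is k - |P|, since the components of `blockEdges p` are the blocks.
blockRank : {k : ℕ} → (Fin k → Fin k) → ℕ
blockRank {k} p = rank (terminals k) (blockEdges p)

∈-blockEdges⁺ : {k : ℕ} (p : Fin k → Fin k) → ∀ {i j} → p i ≡ p j → (i , j) ∈ blockEdges p
∈-blockEdges⁺ p {i} {j} = ∈-filter⁺ _ (∈-cartesianProduct⁺ (∈-allFin i) (∈-allFin j))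

∈-blockEdges⁻ : {k : ℕ} (p : Fin k → Fin k) → ∀ {i j} → (i , j) ∈ blockEdges p → p i ≡ p j
∈-blockEdges⁻ {k} p e = proj₂ (∈-filter⁻ _ {xs = cartesianProduct (allFin k) (allFin k)} e)

module Identify (G : Graph) {k : ℕ} (u : Fin k → Fin (n G)) (u-inj : Injective _≡_ _≡_ u)
                (p : Fin k → Fin k) where

  _≈_ : Fin (n G) → Fin (n G) → Set
  x ≈ y = x ≡ y ⊎ ∃ λ i → ∃ λ j → u i ≡ x × u j ≡ y × p i ≡ p j

  ≈-isEquivalence : IsEquivalence _≈_
  ≈-isEquivalence = record
    { refl = inj₁ refl
    ; sym = λ { (inj₁ eq) → inj₁ (sym eq)
              ; (inj₂ (i , j , ui , uj , pij)) → inj₂ (j , i , uj , ui , sym pij) }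
    ; trans = ≈-trans }
    where
    ≈-trans : ∀ {x y z} → x ≈ y → y ≈ z → x ≈ z
    ≈-trans (inj₁ refl) yz = yz
    ≈-trans (inj₂ xy) (inj₁ refl) = inj₂ xy
    -- Injectivity of `u` gives the middle vertex a single index, so the two block equations chain.
    ≈-trans (inj₂ (i , j , ui , uj , pij)) (inj₂ (i′ , j′ , ui′ , uj′ , pij′))
      with refl ← u-inj (trans uj (sym ui′)) = inj₂ (i , j′ , ui , uj′ , trans pij pij′)

  -- Repeats the relation local to `identify`, so that the codomain of `π` is the vertex set of
  -- `G/p` by computation.
  same : Fin (n G) → Fin (n G) → Bool
  same x y = (x == y) ∨ anyFin k (λ i → anyFin k (λ j →
               (u i == x) ∧ (u j == y) ∧ (p i == p j)))

  same-reflects : ∀ x y → Reflects (x ≈ y) (same x y)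
  same-reflects x y = ==-reflects x y ⊎-reflects anyFin-reflects λ i → anyFin-reflects λ j →
    ==-reflects (u i) x ×-reflects (==-reflects (u j) y ×-reflects ==-reflects (p i) (p j))

  G/p : Graph
  G/p = identify G u p

  π : Fin (n G) → Fin (n G/p)
  π = proj₂ (quotientMap (n G) same)

  π-injective : ∀ {x y} → π x ≡ π y → x ≈ y
  π-injective = quotientMap-injective (n G) ≈-isEquivalence same-reflects

  π-block : ∀ {i j} → p i ≡ p j → π (u i) ≡ π (u j)
  π-block pij = quotientMap-cong (n G) ≈-isEquivalence same-reflects (inj₂ (_ , _ , refl , refl , pij))

  -- The instance of `rank-contract` with the identity on one side: adding the block edges to `G`
  -- connects the same vertices as passing to the quotient does.
  rank-identify : ∀ A → rank G (A ++ mapEdges u (blockEdges p)) ≡ rank G/p (mapEdges π A) + blockRank p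
  rank-identify A = begin
    rank G (A ++ F)                        ≡⟨ cong (λ A → rank G (A ++ F)) (map-id A) ⟨
    rank G (mapEdges id A ++ F)            ≡⟨ rank-contract G G/p id π F to from A ⟩
    rank G/p (mapEdges π A) + rank G F     ≡⟨ cong (rank G/p (mapEdges π A) +_)
                                                (rank-embed (terminals k) G u u-inj (blockEdges p)) ⟩
    rank G/p (mapEdges π A) + blockRank p  ∎
    where
    open ≡-Reasoning
    F : Edges (n G)
    F = mapEdges u (blockEdges p)

    to : ∀ A {x y} → Conn (mapEdges id A ++ F) x y → Conn (mapEdges π A) (π x) (π y)
    to A = Eq.gfold (Eq.isEquivalence _) π (edge ∘ ∈-++⁻ (mapEdges id A))
      where
      edge : ∀ {x y} → (x , y) ∈ mapEdges id A ⊎ (x , y) ∈ F → Conn (mapEdges π A) (π x) (π y)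
      edge (inj₁ e) with _ , e∈A , refl ← ∈-map⁻ _ e = conn-edge (∈-map⁺ _ e∈A)
      edge (inj₂ e) with _ , e∈F , refl ← ∈-map⁻ _ e =
        subst (Conn _ _) (π-block (∈-blockEdges⁻ p e∈F)) ε

    from : ∀ A {x y} → Conn (mapEdges π A) (π x) (π y) → Conn (mapEdges id A ++ F) x y
    from A = conn-lift (Eq.isEquivalence _) π (fibre ∘ π-injective)
      (λ e → conn-edge (∈-++⁺ˡ (∈-map⁺ _ e)))
      where
      fibre : ∀ {x y} → x ≈ y → Conn (mapEdges id A ++ F) x y
      fibre (inj₁ refl) = ε
      fibre (inj₂ (i , j , refl , refl , pij)) =
        conn-edge (∈-++⁺ʳ (mapEdges id A) (∈-map⁺ _ (∈-blockEdges⁺ p pij)))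

  -- The right-hand side does not mention `p`. Comparing two partitions thus turns a difference of
  -- full ranks of quotients into a difference of block ranks.
  rank-identify-E : Connected G → rank G/p (E G/p) + blockRank p ≡ rank G (E G)
  rank-identify-E conn = trans (sym (rank-identify (E G))) (rank-spanning G conn _)

-- Gluing

module Glue (G W : Graph) {k : ℕ} (u : Fin k → Fin (n G)) (u-inj : Injective _≡_ _≡_ u)
            (w : Fin k → Fin (n W)) (w-inj : Injective _≡_ _≡_ w) where

  left : Fin (n G) → Fin (n G + n W)
  left x = x ↑ˡ n W

  right : Fin (n W) → Fin (n G + n W)
  right y = n G ↑ʳ y

  left≢right : ∀ {x y} → left x ≢ right y
  left≢right {x} {y} eq
    with () ← trans (sym (Fin.splitAt-↑ˡ (n G) x (n W)))
                    (trans (cong (splitAt (n G)) eq) (Fin.splitAt-↑ʳ (n G) (n W) y))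

  left-inj : ∀ {x y} → left x ≡ left y → x ≡ y
  left-inj = Fin.↑ˡ-injective (n W) _ _

  right-inj : ∀ {x y} → right x ≡ right y → x ≡ y
  right-inj = Fin.↑ʳ-injective (n G) _ _

  _≈_ : Fin (n G + n W) → Fin (n G + n W) → Set
  x ≈ y = x ≡ y ⊎ ∃ λ i → (x ≡ left (u i) × y ≡ right (w i)) ⊎ (y ≡ left (u i) × x ≡ right (w i))

  ≈-isEquivalence : IsEquivalence _≈_
  ≈-isEquivalence = record
    { refl = inj₁ refl
    ; sym = λ { (inj₁ eq) → inj₁ (sym eq) ; (inj₂ (i , xy)) → inj₂ (i , swap xy) }
    ; trans = ≈-trans }
    where
    ≈-trans : ∀ {x y z} → x ≈ y → y ≈ z → x ≈ z
    ≈-trans (inj₁ refl) yz = yz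
    ≈-trans (inj₂ xy) (inj₁ refl) = inj₂ xy
    -- Two successive links either put the middle vertex on both sides, which is absurd, or share it
    -- on one side; then injectivity of `w` or `u` makes their indices equal and they cancel.
    ≈-trans (inj₂ (i , inj₁ (_ , y≡))) (inj₂ (j , inj₁ (y≡′ , _))) =
      contradiction (trans (sym y≡′) y≡) left≢right
    ≈-trans (inj₂ (i , inj₁ (x≡ , y≡))) (inj₂ (j , inj₂ (z≡ , y≡′)))
      with refl ← w-inj (right-inj (trans (sym y≡) y≡′)) = inj₁ (trans x≡ (sym z≡))
    ≈-trans (inj₂ (i , inj₂ (y≡ , x≡))) (inj₂ (j , inj₁ (y≡′ , z≡)))
      with refl ← u-inj (left-inj (trans (sym y≡) y≡′)) = inj₁ (trans x≡ (sym z≡))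
    ≈-trans (inj₂ (i , inj₂ (y≡ , _))) (inj₂ (j , inj₂ (_ , y≡′))) =
      contradiction (trans (sym y≡) y≡′) left≢right

  same : Fin (n G + n W) → Fin (n G + n W) → Bool
  same x y = (x == y) ∨ anyFin k (λ i →
               ((x == (u i ↑ˡ n W)) ∧ (y == (n G ↑ʳ w i)))
             ∨ ((y == (u i ↑ˡ n W)) ∧ (x == (n G ↑ʳ w i))))

  same-reflects : ∀ x y → Reflects (x ≈ y) (same x y)
  same-reflects x y = ==-reflects x y ⊎-reflects anyFin-reflects λ i →
    (==-reflects x (left (u i)) ×-reflects ==-reflects y (right (w i)))
      ⊎-reflects (==-reflects y (left (u i)) ×-reflects ==-reflects x (right (w i)))

  G⊔W : Graph
  G⊔W = glue G W u w

  private
    κ : Fin (n G + n W) → Fin (n G⊔W)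
    κ = proj₂ (quotientMap (n G + n W) same)

    κ-injective : ∀ {x y} → κ x ≡ κ y → x ≈ y
    κ-injective = quotientMap-injective (n G + n W) ≈-isEquivalence same-reflects

  ιG : Fin (n G) → Fin (n G⊔W)
  ιG = κ ∘ left

  ιW : Fin (n W) → Fin (n G⊔W)
  ιW = κ ∘ right

  ιG-inj : ∀ {x y} → ιG x ≡ ιG y → x ≡ y
  ιG-inj eq with κ-injective eq
  ... | inj₁ eq′ = left-inj eq′
  ... | inj₂ (i , inj₁ (_ , y≡)) = contradiction y≡ left≢right
  ... | inj₂ (i , inj₂ (_ , x≡)) = contradiction x≡ left≢right

  ιW-inj : ∀ {x y} → ιW x ≡ ιW y → x ≡ y
  ιW-inj eq with κ-injective eq
  ... | inj₁ eq′ = right-inj eq′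
  ... | inj₂ (i , inj₁ (x≡ , _)) = contradiction (sym x≡) left≢right
  ... | inj₂ (i , inj₂ (y≡ , _)) = contradiction (sym y≡) left≢right

  ιG≡ιW⇒terminal : ∀ {x y} → ιG x ≡ ιW y → ∃ λ i → x ≡ u i × y ≡ w i
  ιG≡ιW⇒terminal eq with κ-injective eq
  ... | inj₁ eq′ = contradiction eq′ left≢right
  ... | inj₂ (i , inj₁ (x≡ , y≡)) = i , left-inj x≡ , right-inj y≡
  ... | inj₂ (i , inj₂ (_ , x≡)) = contradiction x≡ left≢right

  ι-terminal : ∀ i → ιG (u i) ≡ ιW (w i)
  ι-terminal i = quotientMap-cong (n G + n W) ≈-isEquivalence same-reflects (inj₂ (i , inj₁ (refl , refl)))

  E-glue : E G⊔W ≡ mapEdges ιG (E G) ++ mapEdges ιW (E W)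
  E-glue = trans (map-++ _ (map _ (E G)) (map _ (E W)))
                 (cong₂ _++_ (sym (map-∘ (E G))) (sym (map-∘ (E W))))

  module _ (p : Fin k → Fin k) (B : Edges (n W))
           (p⇒conn : ∀ {i j} → p i ≡ p j → Conn B (w i) (w j))
           (conn⇒p : ∀ {i j} → Conn B (w i) (w j) → p i ≡ p j) where
    open Identify G u u-inj p using (G/p; π; π-injective; π-block) renaming (_≈_ to _∼_)

    private
      A∪B : Edges (n G) → Edges (n G⊔W)
      A∪B A = mapEdges ιG A ++ mapEdges ιW B

      to : ∀ A {x y} → Conn (A∪B A) (ιG x) (ιG y) → Conn (mapEdges π A) (π x) (π y)
      to A {y = y} c = proj₁ (trace c) refl
        where
        -- A walk ending in G is followed backwards; a stretch inside W is remembered by a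
        -- terminal that its B-component contains.
        Trace : Fin (n G⊔W) → Set
        Trace r = (∀ {x} → r ≡ ιG x → Conn (mapEdges π A) (π x) (π y))
          × (∀ {z} → r ≡ ιW z → ∃ λ i → Conn B z (w i) × Conn (mapEdges π A) (π (u i)) (π y))

        inG : ∀ {a} → Conn (mapEdges π A) (π a) (π y) → Trace (ιG a)
        inG {a} c = (λ eq → subst (λ x → Conn _ (π x) (π y)) (ιG-inj eq) c) , stepW
          where
          stepW : ∀ {z} → ιG a ≡ ιW z → ∃ λ i → Conn B z (w i) × Conn (mapEdges π A) (π (u i)) (π y)
          stepW eq with i , refl , refl ← ιG≡ιW⇒terminal eq = i , ε , c

        inW : ∀ {a} → (∃ λ i → Conn B a (w i) × Conn (mapEdges π A) (π (u i)) (π y)) → Trace (ιW a)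
        inW {a} (i , ai , iy) = stepG , λ eq → i , subst (λ z → Conn B z (w i)) (ιW-inj eq) ai , iy
          where
          stepG : ∀ {x} → ιW a ≡ ιG x → Conn (mapEdges π A) (π x) (π y)
          -- The vertex is terminal `j`, joined by `B` to terminal `i`. Both lie in one block, so
          -- this stretch inside `W` shrinks to a point under `π`.
          stepG eq with j , refl , refl ← ιG≡ιW⇒terminal (sym eq) =
            subst (λ v → Conn _ v (π y)) (sym (π-block (conn⇒p ai))) iy

        edgeG : ∀ {a b} → Conn (mapEdges π A) (π a) (π b) → Trace (ιG b) → Trace (ιG a)
        edgeG ab tb = inG (ab ◅◅ proj₁ tb refl)

        edgeW : ∀ {a b} → Conn B a b → Trace (ιW b) → Trace (ιW a)
        edgeW ab tb = let i , bi , iy = proj₂ tb refl in inW (i , ab ◅◅ bi , iy)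

        trace : ∀ {r} → Conn (A∪B A) r (ιG y) → Trace r
        trace ε = inG ε
        trace (fwd e ◅ c) with ∈-++⁻ (mapEdges ιG A) e
        ... | inj₁ e with _ , e∈A , refl ← ∈-map⁻ _ e = edgeG (conn-edge (∈-map⁺ _ e∈A)) (trace c)
        ... | inj₂ e with _ , e∈B , refl ← ∈-map⁻ _ e = edgeW (conn-edge e∈B) (trace c)
        trace (bwd e ◅ c) with ∈-++⁻ (mapEdges ιG A) e
        ... | inj₁ e with _ , e∈A , refl ← ∈-map⁻ _ e =
          edgeG (conn-sym (conn-edge (∈-map⁺ _ e∈A))) (trace c)
        ... | inj₂ e with _ , e∈B , refl ← ∈-map⁻ _ e = edgeW (conn-sym (conn-edge e∈B)) (trace c)

      from : ∀ A {x y} → Conn (mapEdges π A) (π x) (π y) → Conn (A∪B A) (ιG x) (ιG y)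
      from A = conn-lift (On.isEquivalence ιG (Eq.isEquivalence _)) π (fibre ∘ π-injective)
        (λ e → conn-edge (∈-++⁺ˡ (∈-map⁺ _ e)))
        where
        fibre : ∀ {x y} → x ∼ y → Conn (A∪B A) (ιG x) (ιG y)
        fibre (inj₁ refl) = ε
        fibre (inj₂ (i , j , refl , refl , pij)) = subst₂ (Conn (A∪B A)) (sym (ι-terminal i)) (sym (ι-terminal j))
          (conn-mono (∈-++⁺ʳ (mapEdges ιG A)) (conn-map ιW (p⇒conn pij)))

    rank-glue : ∀ A → rank G⊔W (mapEdges ιG A ++ mapEdges ιW B) ≡ rank G/p (mapEdges π A) + rank W B
    rank-glue A = trans (rank-contract G⊔W G/p ιG π (mapEdges ιW B) to from A)
      (cong (rank G/p (mapEdges π A) +_) (rank-embed W G⊔W ιW ιW-inj B))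

module TerminalPartition {k : ℕ} (W : Graph) (w : Fin k → Fin (n W)) (B : Edges (n W)) where
  open Quotient (On.isEquivalence w (Eq.isEquivalence _))
    (λ i j → conn-reflects B (w i) (w j))

  -- Each block is labelled by its least terminal, which yields a labelling `Fin k → Fin k` of the
  -- kind used by `identify`.
  partition : Fin k → Fin k
  partition = rep (λ i j → connected B (w i) (w j))

  partition⇒conn : ∀ {i j} → partition i ≡ partition j → Conn B (w i) (w j)
  partition⇒conn = rep-injective

  conn⇒partition : ∀ {i j} → Conn B (w i) (w j) → partition i ≡ partition j
  conn⇒partition = rep-cong

-- Powers of x − 1

nC0≡1 : ∀ a → a C 0 ≡ 1
nC0≡1 a = trans (nCk≡nC[n∸k] {0} {a} z≤n) (nCn≡1 a)

coeffPow-suc-zero : ∀ a → coeffPow (suc a) 0 ≡ - coeffPow a 0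
coeffPow-suc-zero a rewrite nC0≡1 a | nC0≡1 (suc a) = sym (ℤ.neg-distribʳ-* (ℤ.+ 1) (signPow a))

-- Multiplication by x - 1 read on coefficients; it comes from Pascal's rule.
coeffPow-suc-suc : ∀ a i → coeffPow (suc a) (suc i) ≡ coeffPow a i -ℤ coeffPow a (suc i)
coeffPow-suc-suc a i = begin
  ℤ.+ (suc a C suc i) *ℤ signPow (a ∸ i)                  ≡⟨ cong (λ c → ℤ.+ c *ℤ signPow (a ∸ i)) (nCk+nC[k+1]≡[n+1]C[k+1] a i) ⟨
  ℤ.+ (a C i + a C suc i) *ℤ signPow (a ∸ i)              ≡⟨ ℤ.*-distribʳ-+ (signPow (a ∸ i)) (ℤ.+ (a C i)) (ℤ.+ (a C suc i)) ⟩
  coeffPow a i +ℤ ℤ.+ (a C suc i) *ℤ signPow (a ∸ i)      ≡⟨ cong (coeffPow a i +ℤ_) lower ⟩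
  coeffPow a i -ℤ coeffPow a (suc i)                    ∎
  where
  open ≡-Reasoning
  lower : ℤ.+ (a C suc i) *ℤ signPow (a ∸ i) ≡ - coeffPow a (suc i)
  -- The sign flips only while `a ∸ suc i` is a genuine difference; once `i ≥ a` the binomial
  -- coefficient is 0 and both sides vanish.
  lower with suc i ≤? a
  ... | yes i<a = begin
    ℤ.+ (a C suc i) *ℤ signPow (a ∸ i)            ≡⟨ cong (λ t → ℤ.+ (a C suc i) *ℤ signPow t) (+-∸-assoc 1 i<a) ⟩
    ℤ.+ (a C suc i) *ℤ (- signPow (a ∸ suc i))    ≡⟨ ℤ.neg-distribʳ-* (ℤ.+ (a C suc i)) (signPow (a ∸ suc i)) ⟨
    - coeffPow a (suc i)                        ∎
  ... | no i≮a rewrite k>n⇒nCk≡0 (≰⇒> i≮a) = refl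

-- Sums over sublists

sumSub : {X : Set} → (List X → ℤ) → List X → ℤ
sumSub F [] = F []
sumSub F (x ∷ xs) = sumSub (F ∘ (x ∷_)) xs +ℤ sumSub F xs

foldr-++-+ : ∀ xs ys → foldr _+ℤ_ (ℤ.+ 0) (xs ++ ys) ≡ foldr _+ℤ_ (ℤ.+ 0) xs +ℤ foldr _+ℤ_ (ℤ.+ 0) ys
foldr-++-+ [] ys = sym (ℤ.+-identityˡ _)
foldr-++-+ (x ∷ xs) ys = trans (cong (x +ℤ_) (foldr-++-+ xs ys)) (sym (ℤ.+-assoc x _ _))

sum-sublists : {X : Set} (F : List X → ℤ) → ∀ xs →
  foldr _+ℤ_ (ℤ.+ 0) (map F (sublists xs)) ≡ sumSub F xs
sum-sublists F [] = ℤ.+-identityʳ (F [])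
sum-sublists F (x ∷ xs) = begin
  Σℤ (map F (map (x ∷_) (sublists xs) ++ sublists xs))              ≡⟨ cong Σℤ (map-++ F (map (x ∷_) (sublists xs)) (sublists xs)) ⟩
  Σℤ (map F (map (x ∷_) (sublists xs)) ++ map F (sublists xs))      ≡⟨ foldr-++-+ (map F (map (x ∷_) (sublists xs))) _ ⟩
  Σℤ (map F (map (x ∷_) (sublists xs))) +ℤ Σℤ (map F (sublists xs)) ≡⟨ cong (λ l → Σℤ l +ℤ Σℤ (map F (sublists xs))) (map-∘ (sublists xs)) ⟨
  Σℤ (map (F ∘ (x ∷_)) (sublists xs)) +ℤ Σℤ (map F (sublists xs))   ≡⟨ cong₂ _+ℤ_ (sum-sublists (F ∘ (x ∷_)) xs) (sum-sublists F xs) ⟩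
  sumSub F (x ∷ xs)                                                 ∎
  where
  open ≡-Reasoning
  Σℤ = foldr _+ℤ_ (ℤ.+ 0)

-- The inclusion `A ⊆ xs` is handed on because the corank identity holds for subsets of the edge
-- set, where monotonicity of rank keeps the subtractions genuine.
sumSub-cong : {X : Set} {F H : List X → ℤ} → ∀ xs → (∀ A → A ⊆ xs → F A ≡ H A) → sumSub F xs ≡ sumSub H xs
sumSub-cong [] h = h [] id
sumSub-cong (x ∷ xs) h = cong₂ _+ℤ_
  (sumSub-cong xs λ A A⊆xs → h (x ∷ A) (∷⁺ʳ x A⊆xs))
  (sumSub-cong xs λ A A⊆xs → h A (there ∘ A⊆xs))

sumSub-map : {X Y : Set} (F : List Y → ℤ) (f : X → Y) → ∀ xs → sumSub F (map f xs) ≡ sumSub (F ∘ map f) xs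
sumSub-map F f [] = refl
sumSub-map F f (x ∷ xs) = cong₂ _+ℤ_ (sumSub-map (F ∘ (f x ∷_)) f xs) (sumSub-map F f xs)

sumSub-+ : {X : Set} (F H : List X → ℤ) → ∀ xs → sumSub (λ A → F A +ℤ H A) xs ≡ sumSub F xs +ℤ sumSub H xs
sumSub-+ F H [] = refl
sumSub-+ F H (x ∷ xs) = trans
  (cong₂ _+ℤ_ (sumSub-+ (F ∘ (x ∷_)) (H ∘ (x ∷_)) xs) (sumSub-+ F H xs))
  (interchange (sumSub (F ∘ (x ∷_)) xs) (sumSub (H ∘ (x ∷_)) xs) (sumSub F xs) (sumSub H xs))
  where
  interchange : ∀ a b c d → (a +ℤ b) +ℤ (c +ℤ d) ≡ (a +ℤ c) +ℤ (b +ℤ d)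
  interchange = solve 4 (λ a b c d → (a :+ b) :+ (c :+ d) := (a :+ c) :+ (b :+ d)) refl
    where open ℤ-Solver.+-*-Solver

sumSub-neg : {X : Set} (F : List X → ℤ) → ∀ xs → sumSub (λ A → - F A) xs ≡ - sumSub F xs
sumSub-neg F [] = refl
sumSub-neg F (x ∷ xs) = trans (cong₂ _+ℤ_ (sumSub-neg (F ∘ (x ∷_)) xs) (sumSub-neg F xs))
  (sym (ℤ.neg-distrib-+ (sumSub (F ∘ (x ∷_)) xs) (sumSub F xs)))

sumSub-minus : {X : Set} (F H : List X → ℤ) → ∀ xs → sumSub (λ A → F A -ℤ H A) xs ≡ sumSub F xs -ℤ sumSub H xs
sumSub-minus F H xs = trans (sumSub-+ F (-_ ∘ H) xs) (cong (sumSub F xs +ℤ_) (sumSub-neg H xs))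

sumSub-++ : {X : Set} (F : List X → ℤ) → ∀ xs ys →
  sumSub F (xs ++ ys) ≡ sumSub (λ B → sumSub (λ A → F (A ++ B)) xs) ys
sumSub-++ F [] ys = refl
sumSub-++ F (x ∷ xs) ys = trans
  (cong₂ _+ℤ_ (sumSub-++ (F ∘ (x ∷_)) xs ys) (sumSub-++ F xs ys))
  (sym (sumSub-+ (λ B → sumSub (λ A → F (x ∷ A ++ B)) xs) (λ B → sumSub (λ A → F (A ++ B)) xs) ys))

-- The coefficients of (x − 1)^b (y − 1)^d Σ_A (x − 1)^(α A) (y − 1)^(β A).
module Shifted {X : Set} (xs : List X) (α β : List X → ℕ) where

  shifted : ℕ → ℕ → ℕ → ℕ → ℤ
  shifted b d i j = sumSub (λ A → coeffPow (b + α A) i *ℤ coeffPow (d + β A) j) xs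

  shifted-sucˡ-zero : ∀ b d j → shifted (suc b) d 0 j ≡ - shifted b d 0 j
  shifted-sucˡ-zero b d j = trans
    (sumSub-cong xs λ A _ → trans (cong (_*ℤ coeffPow (d + β A) j) (coeffPow-suc-zero (b + α A)))
      (sym (ℤ.neg-distribˡ-* (coeffPow (b + α A) 0) (coeffPow (d + β A) j))))
    (sumSub-neg (λ A → coeffPow (b + α A) 0 *ℤ coeffPow (d + β A) j) xs)

  shifted-sucˡ-suc : ∀ b d i j → shifted (suc b) d (suc i) j ≡ shifted b d i j -ℤ shifted b d (suc i) j
  shifted-sucˡ-suc b d i j = trans
    (sumSub-cong xs λ A _ → trans (cong (_*ℤ coeffPow (d + β A) j) (coeffPow-suc-suc (b + α A) i))
      (distrib (coeffPow (b + α A) i) (coeffPow (b + α A) (suc i)) (coeffPow (d + β A) j)))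
    (sumSub-minus (λ A → coeffPow (b + α A) i *ℤ coeffPow (d + β A) j)
                  (λ A → coeffPow (b + α A) (suc i) *ℤ coeffPow (d + β A) j) xs)
    where
    distrib : ∀ p q r → (p -ℤ q) *ℤ r ≡ p *ℤ r -ℤ q *ℤ r
    distrib = solve 3 (λ p q r → (p :- q) :* r := p :* r :- q :* r) refl
      where open ℤ-Solver.+-*-Solver

  shifted-sucʳ-zero : ∀ b d i → shifted b (suc d) i 0 ≡ - shifted b d i 0
  shifted-sucʳ-zero b d i = trans
    (sumSub-cong xs λ A _ → trans (cong (coeffPow (b + α A) i *ℤ_) (coeffPow-suc-zero (d + β A)))
      (sym (ℤ.neg-distribʳ-* (coeffPow (b + α A) i) (coeffPow (d + β A) 0))))
    (sumSub-neg (λ A → coeffPow (b + α A) i *ℤ coeffPow (d + β A) 0) xs)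

  shifted-sucʳ-suc : ∀ b d i j → shifted b (suc d) i (suc j) ≡ shifted b d i j -ℤ shifted b d i (suc j)
  shifted-sucʳ-suc b d i j = trans
    (sumSub-cong xs λ A _ → trans (cong (coeffPow (b + α A) i *ℤ_) (coeffPow-suc-suc (d + β A) j))
      (distrib (coeffPow (b + α A) i) (coeffPow (d + β A) j) (coeffPow (d + β A) (suc j))))
    (sumSub-minus (λ A → coeffPow (b + α A) i *ℤ coeffPow (d + β A) j)
                  (λ A → coeffPow (b + α A) i *ℤ coeffPow (d + β A) (suc j)) xs)
    where
    distrib : ∀ r p q → r *ℤ (p -ℤ q) ≡ r *ℤ p -ℤ r *ℤ q
    distrib = solve 3 (λ r p q → r :* (p :- q) := r :* p :- r :* q) refl
      where open ℤ-Solver.+-*-Solver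

module _ {X Y : Set} (xs : List X) (α β : List X → ℕ) (ys : List Y) (α′ β′ : List Y → ℕ) where
  open Shifted xs α β
  open Shifted ys α′ β′ using () renaming (shifted to shifted′;
    shifted-sucˡ-zero to sucˡ-zero′; shifted-sucˡ-suc to sucˡ-suc′;
    shifted-sucʳ-zero to sucʳ-zero′; shifted-sucʳ-suc to sucʳ-suc′)

  -- The two sums range over unrelated lists and agree only in total. Multiplying by x - 1 or y - 1
  -- expresses each new coefficient through old ones, so the agreement passes up by induction on `b`
  -- and `d`.
  shifted-cong : (∀ i j → shifted 0 0 i j ≡ shifted′ 0 0 i j) → ∀ b d i j → shifted b d i j ≡ shifted′ b d i j
  shifted-cong h zero zero i j = h i j
  shifted-cong h zero (suc d) i zero = trans (shifted-sucʳ-zero 0 d i)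
    (trans (cong -_ (shifted-cong h 0 d i 0)) (sym (sucʳ-zero′ 0 d i)))
  shifted-cong h zero (suc d) i (suc j) = trans (shifted-sucʳ-suc 0 d i j)
    (trans (cong₂ _-ℤ_ (shifted-cong h 0 d i j) (shifted-cong h 0 d i (suc j))) (sym (sucʳ-suc′ 0 d i j)))
  shifted-cong h (suc b) d zero j = trans (shifted-sucˡ-zero b d j)
    (trans (cong -_ (shifted-cong h b d 0 j)) (sym (sucˡ-zero′ b d j)))
  shifted-cong h (suc b) d (suc i) j = trans (shifted-sucˡ-suc b d i j)
    (trans (cong₂ _-ℤ_ (shifted-cong h b d i j) (shifted-cong h b d (suc i) j)) (sym (sucˡ-suc′ b d i j)))

-- The Tutte polynomial of a glued graph

∸-distrib-+ : ∀ {a b c d} → c ≤ a → d ≤ b → (a + b) ∸ (c + d) ≡ (b ∸ d) + (a ∸ c)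
∸-distrib-+ {a} {b} {c} {d} c≤a d≤b = begin
  (a + b) ∸ (c + d)  ≡⟨ ∸-+-assoc (a + b) c d ⟨
  (a + b ∸ c) ∸ d    ≡⟨ cong (_∸ d) (+-∸-comm b c≤a) ⟩
  (a ∸ c + b) ∸ d    ≡⟨ +-∸-assoc (a ∸ c) d≤b ⟩
  (a ∸ c) + (b ∸ d)  ≡⟨ +-comm (a ∸ c) (b ∸ d) ⟩
  (b ∸ d) + (a ∸ c)  ∎
  where open ≡-Reasoning

-- P stands for P_B and Q for P_E; `rP`, `rQ` are the full ranks of the two quotients of G, `βP`,
-- `βQ` the block ranks. Over ℤ this is rQ - rP = βP - βQ. Here `βP + βQ` is first added to both
-- sides of the subtraction, and the last hypothesis makes the shift a genuine difference.
corank-split : ∀ {rP rQ βP βQ rA wE wB} → rP + βP ≡ rQ + βQ → rA ≤ rP → rP + wB ≤ rQ + wE →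
  (rQ + wE) ∸ (rA + wB) ≡ ((βP + wE) ∸ (βQ + wB)) + (rP ∸ rA)
corank-split {rP} {rQ} {βP} {βQ} {rA} {wE} {wB} PQ rA≤rP mono = begin
  (rQ + wE) ∸ (rA + wB)                                ≡⟨ [m+n]∸[m+o]≡n∸o (βP + βQ) (rQ + wE) (rA + wB) ⟨
  (βP + βQ + (rQ + wE)) ∸ (βP + βQ + (rA + wB))        ≡⟨ cong₂ _∸_ top (bottom βP βQ rA wB) ⟩
  (βP + (rP + (βP + wE))) ∸ (βP + (rA + (βQ + wB)))    ≡⟨ [m+n]∸[m+o]≡n∸o βP _ _ ⟩
  (rP + (βP + wE)) ∸ (rA + (βQ + wB))                  ≡⟨ ∸-distrib-+ rA≤rP β-mono ⟩
  ((βP + wE) ∸ (βQ + wB)) + (rP ∸ rA)                  ∎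
  where
  open ≡-Reasoning
  open ℕ-Solver.+-*-Solver

  regroup : ∀ p q r e → p + q + (r + e) ≡ (r + q) + (p + e)
  regroup = solve 4 (λ p q r e → p :+ q :+ (r :+ e) := (r :+ q) :+ (p :+ e)) refl

  regroup′ : ∀ p q r e → p + q + (r + e) ≡ (r + p) + (q + e)
  regroup′ = solve 4 (λ p q r e → p :+ q :+ (r :+ e) := (r :+ p) :+ (q :+ e)) refl

  bottom : ∀ p q r e → p + q + (r + e) ≡ p + (r + (q + e))
  bottom = solve 4 (λ p q r e → p :+ q :+ (r :+ e) := p :+ (r :+ (q :+ e))) refl

  top : βP + βQ + (rQ + wE) ≡ βP + (rP + (βP + wE))
  top = trans (regroup βP βQ rQ wE) (trans (cong (_+ (βP + wE)) (trans (sym PQ) (+-comm rP βP)))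
    (+-assoc βP rP (βP + wE)))

  β-mono : βQ + wB ≤ βP + wE
  β-mono = +-cancelˡ-≤ (rQ + βQ) _ _ (subst₂ _≤_
    (trans (regroup′ βP βQ rP wB) (cong (_+ (βQ + wB)) PQ)) (regroup βP βQ rQ wE)
    (+-monoʳ-≤ (βP + βQ) mono))

module TutteIdentify (G : Graph) {k : ℕ} (u : Fin k → Fin (n G)) (u-inj : Injective _≡_ _≡_ u)
                     (p : Fin k → Fin k) where
  open Identify G u u-inj p

  -- Indexed by sublists of `E G` and not of `E G/p`, so that one range of summation serves all
  -- partitions.
  corank nullity : Edges (n G) → ℕ
  corank A = rank G/p (E G/p) ∸ rank G/p (mapEdges π A)
  nullity A = length A ∸ rank G/p (mapEdges π A)

  open Shifted (E G) corank nullity public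

  tutte-identify : ∀ i j → tutte G/p i j ≡ shifted 0 0 i j
  tutte-identify i j = trans (sum-sublists _ (E G/p)) (trans (sumSub-map _ _ (E G))
    (sumSub-cong (E G) λ A _ → cong (λ l → coeffPow (corank A) i *ℤ
      coeffPow (l ∸ rank G/p (mapEdges π A)) j) (length-map _ A)))

module _ {k : ℕ} (W : Graph) (w : Fin k → Fin (n W)) where
  open TerminalPartition W w

  -- `corankShift` is b(B) with the full ranks of the quotients of G replaced by block ranks: built
  -- from `W` and `w` alone, it is shared by G and H.
  corankShift nullityShift : Edges (n W) → ℕ
  corankShift B = (blockRank (partition B) + rank W (E W)) ∸ (blockRank (partition (E W)) + rank W B)
  nullityShift B = length B ∸ rank W B

  module TutteGlue (w-inj : Injective _≡_ _≡_ w) (G : Graph) (conn : Connected G)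
                   (u : Fin k → Fin (n G)) (u-inj : Injective _≡_ _≡_ u) where
    open Glue G W u u-inj w w-inj
    open TutteIdentify G u u-inj
    open Identify G u u-inj

    private
      rank-⊔ : ∀ A B → rank G⊔W (mapEdges ιG A ++ mapEdges ιW B)
        ≡ rank (G/p (partition B)) (mapEdges (π (partition B)) A) + rank W B
      rank-⊔ A B = rank-glue (partition B) B (partition⇒conn B) (conn⇒partition B) A

      -- By `rank-⊔` the two sides are ranks in the glued graph, of E(G) ∪ B and of E(G) ∪ E(W).
      rank-E-mono : ∀ {B} → B ⊆ E W →
        rank (G/p (partition B)) (E (G/p (partition B))) + rank W B
          ≤ rank (G/p (partition (E W))) (E (G/p (partition (E W)))) + rank W (E W)
      rank-E-mono {B} B⊆E = subst₂ _≤_ (rank-⊔ (E G) B) (rank-⊔ (E G) (E W))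
        (rank-mono G⊔W (++⁺ (⊆-refl {x = mapEdges ιG (E G)}) (map⁺ _ B⊆E)))

      corank-⊔ : ∀ {A B} → A ⊆ E G → B ⊆ E W →
        rank G⊔W (E G⊔W) ∸ rank G⊔W (mapEdges ιG A ++ mapEdges ιW B)
          ≡ corankShift B + corank (partition B) A
      corank-⊔ {A} {B} A⊆E B⊆E =
        trans (cong₂ _∸_ (trans (cong (rank G⊔W) E-glue) (rank-⊔ (E G) (E W))) (rank-⊔ A B))
          (corank-split {rP = rank (G/p (partition B)) (E (G/p (partition B)))}
            {rQ = rank (G/p (partition (E W))) (E (G/p (partition (E W))))}
            {βQ = blockRank (partition (E W))} {wE = rank W (E W)}
            (trans (rank-identify-E (partition B) conn) (sym (rank-identify-E (partition (E W)) conn)))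
            (rank-mono (G/p (partition B)) (map⁺ _ A⊆E)) (rank-E-mono B⊆E))

      nullity-⊔ : ∀ A B → length (mapEdges ιG A ++ mapEdges ιW B) ∸ rank G⊔W (mapEdges ιG A ++ mapEdges ιW B)
        ≡ nullityShift B + nullity (partition B) A
      nullity-⊔ A B = trans
        (cong₂ _∸_ (trans (length-++ (mapEdges ιG A)) (cong₂ _+_ (length-map _ A) (length-map _ B))) (rank-⊔ A B))
        (∸-distrib-+ (subst (rank (G/p (partition B)) (mapEdges (π (partition B)) A) ≤_) (length-map _ A)
          (rank≤length (G/p (partition B)) (mapEdges (π (partition B)) A))) (rank≤length W B))

    tutte-glue : ∀ i j → tutte (glue G W u w) i j ≡
      sumSub (λ B → shifted (partition B) (corankShift B) (nullityShift B) i j) (E W)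
    tutte-glue i j = begin
      tutte G⊔W i j
        ≡⟨ sum-sublists term (E G⊔W) ⟩
      sumSub term (E G⊔W)
        ≡⟨ cong (sumSub term) E-glue ⟩
      sumSub term (mapEdges ιG (E G) ++ mapEdges ιW (E W))
        ≡⟨ sumSub-++ term (mapEdges ιG (E G)) (mapEdges ιW (E W)) ⟩
      sumSub (λ B → sumSub (λ A → term (A ++ B)) (mapEdges ιG (E G))) (mapEdges ιW (E W))
        ≡⟨ sumSub-map _ _ (E W) ⟩
      sumSub (λ B → sumSub (λ A → term (A ++ mapEdges ιW B)) (mapEdges ιG (E G))) (E W)
        ≡⟨ sumSub-cong (E W) (λ B B⊆E → trans (sumSub-map _ _ (E G))
             (sumSub-cong (E G) λ A A⊆E → cong₂ (λ r s → coeffPow r i *ℤ coeffPow s j)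
               (corank-⊔ A⊆E B⊆E) (nullity-⊔ A B))) ⟩
      sumSub (λ B → shifted (partition B) (corankShift B) (nullityShift B) i j) (E W) ∎
      where
      open ≡-Reasoning
      term : Edges (n G⊔W) → ℤ
      term A = coeffPow (rank G⊔W (E G⊔W) ∸ rank G⊔W A) i *ℤ coeffPow (length A ∸ rank G⊔W A) j

theorem3p3 : (G H : Graph) → Connected G → Connected H →
    (k : ℕ) →
    (u : Fin k → Fin (n G)) → Injective _≡_ _≡_ u →
    (v : Fin k → Fin (n H)) → Injective _≡_ _≡_ v →
    ((p : Fin k → Fin k) → TEquiv (identify G u p) (identify H v p)) →
    (W : Graph) → (w : Fin k → Fin (n W)) → Injective _≡_ _≡_ w →
    TEquiv (glue G W u w) (glue H W v w)
theorem3p3 G H conn-G conn-H k u u-inj v v-inj T-equiv W w w-inj i j = begin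
  tutte (glue G W u w) i j
    ≡⟨ TutteGlue.tutte-glue W w w-inj G conn-G u u-inj i j ⟩
  sumSub (λ B → TG.shifted (partition B) (corankShift W w B) (nullityShift W w B) i j) (E W)
    -- The comparison is made separately for each `B`: the shifts already agree, and the hypothesis
    -- is applied at the partition induced by `B`.
    ≡⟨ sumSub-cong (E W) (λ B _ → shifted-cong (E G) _ _ (E H) _ _ (unshifted (partition B))
         (corankShift W w B) (nullityShift W w B) i j) ⟩
  sumSub (λ B → TH.shifted (partition B) (corankShift W w B) (nullityShift W w B) i j) (E W)
    ≡⟨ TutteGlue.tutte-glue W w w-inj H conn-H v v-inj i j ⟨
  tutte (glue H W v w) i j ∎
  where
  open ≡-Reasoning
  open TerminalPartition W w
  module TG = TutteIdentify G u u-inj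
  module TH = TutteIdentify H v v-inj

  unshifted : ∀ p i j → TG.shifted p 0 0 i j ≡ TH.shifted p 0 0 i j
  unshifted p i j = trans (sym (TG.tutte-identify p i j)) (trans (T-equiv p i j) (TH.tutte-identify p i j))
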